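{- Let $\Gamma$ be a distance-regular graph with intersection array $\{80,54,12;1,6,60\}$. Let $x$ be a vertex of $\Gamma$ and let $\Delta:=\Delta(x)$ be the local graph at $x$. Then $\Delta$ does not contain a coclique with $5$ vertices.
   Context: All graphs are finite, undirected and simple. A connected graph $\Gamma$ of diameter $D$ is distance-regular with intersection array $\{b_0,\ldots,b_{D-1};c_1,\ldots,c_D\}$ if for every $i\in\{0,\ldots,D\}$ and every pair of vertices $x,y$ at distance $i$, the number of neighbors of $y$ at distance $i-1$ from $x$ equals $c_i$ and the number of neighbors of $y$ at distance $i+1$ from $x$ equals $b_i$ (with $c_0=b_D=0$). The local graph $\Delta(x)$ at a vertex $x$ is the subgraph of $\Gamma$ induced on the neighbors of $x$. A coclique is a set of pairwise non-adjacent vertices. -}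

module Defs where

open import Data.Fin using (Fin; toℕ)
open import Data.Fin.Properties using (any?) renaming (_≟_ to _≟ᶠ_)
open import Data.List using (length; filter; allFin)
open import Data.Nat using (ℕ; zero; suc; _<_; _≤_)
open import Data.Nat.Properties using (allUpTo?)
open import Data.Product using (∃; ∃₂; _×_; _,_)
open import Data.Refinement using (Refinement-syntax; value)
open import Data.Vec using (Vec; lookup; _∷ʳ_)
open import Function using (_on_; _↣_)
open import Function.Bundles using (Injection)
open import Relation.Binary using (Rel; Symmetric; Irreflexive)
  renaming (Decidable to Decidable₂)
open import Relation.Binary.PropositionalEquality using (_≡_; _≢_; refl; cong)
open import Relation.Nullary using (¬_; Dec; ¬?; _×-dec_)
open import Relation.Nullary.Decidable using (map′)
open import Relation.Unary using (Pred; Decidable)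
open import Level using (0ℓ)

-- Simple undirected graphs on V; the finite ones with n vertices are the
-- inhabitants of Graph (Fin n).
record Graph (V : Set) : Set₁ where
  infix 4 _~_ _~?_
  field
    _~_      : Rel V 0ℓ
    _~?_     : Decidable₂ _~_
    ~-sym    : Symmetric _~_
    ~-irrefl : Irreflexive _≡_ _~_

-- The proof component of a refinement type is irrelevant, so distinct vertices
-- of the induced subgraph are distinct vertices of the ambient graph.
induced : {V : Set} → Graph V → (P : Pred V 0ℓ) → Graph [ v ∈ V ∣ P v ]
induced Γ P = record
  { _~_      = _~_ on value
  ; _~?_     = λ u v → value u ~? value v
  ; ~-sym    = ~-sym
  ; ~-irrefl = λ u≡v → ~-irrefl (cong value u≡v)
  }
  where open Graph Γ

localGraph : {V : Set} (Γ : Graph V) (x : V) → Graph [ y ∈ V ∣ Graph._~_ Γ x y ]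
localGraph Γ x = induced Γ (Graph._~_ Γ x)

record Coclique {V : Set} (Γ : Graph V) (k : ℕ) : Set where
  open Graph Γ
  field
    vertices : Fin k ↣ V
  open Injection vertices public using () renaming (to to vertex)
  field
    pairwise : ∀ {i j} → i ≢ j → ¬ (vertex i ~ vertex j)

module _ {V : Set} (Γ : Graph V) where
  open Graph Γ

  infixr 5 _∷_
  data Walk : ℕ → V → V → Set where
    []  : ∀ {x} → Walk zero x x
    _∷_ : ∀ {k x y z} → x ~ y → Walk k y z → Walk (suc k) x z

  Connected : Set
  Connected = ∀ x y → ∃ λ k → Walk k x y

  Distance : ℕ → V → V → Set
  Distance d x y = Walk d x y × (∀ {k} → k < d → ¬ Walk k x y)

  record Diameter (D : ℕ) : Set where
    field
      bounded  : ∀ {d x y} → Distance d x y → d ≤ D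
      attained : ∃₂ λ x y → Distance D x y

# : ∀ {n} {P : Pred (Fin n) 0ℓ} → Decidable P → ℕ
# {n} P? = length (filter P? (allFin n))

module _ {n : ℕ} (Γ : Graph (Fin n)) where
  open Graph Γ

  walk? : ∀ k x y → Dec (Walk Γ k x y)
  walk? zero    x y = map′ (λ { refl → [] }) (λ { [] → refl }) (x ≟ᶠ y)
  walk? (suc k) x y =
    map′ (λ { (_ , e , w) → e ∷ w }) (λ { (e ∷ w) → _ , e , w })
         (any? λ z → (x ~? z) ×-dec walk? k z y)

  distance? : ∀ d x y → Dec (Distance Γ d x y)
  distance? d x y = walk? d x y ×-dec allUpTo? (λ k → ¬? (walk? k x y)) d

  #neighboursAt : (d : ℕ) (x y : Fin n) → ℕ
  #neighboursAt d x y = # λ z → (y ~? z) ×-dec distance? d x z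

  -- bs lists b₀ … b_{D-1} and cs lists c₁ … c_D.  The convention b_D = 0 is the
  -- final entry of bs ∷ʳ 0; c₀ = 0 imposes nothing, since no vertex lies at
  -- distance -1.
  record DistanceRegular {D : ℕ} (bs cs : Vec ℕ D) : Set where
    field
      connected : Connected Γ
      diameter  : Diameter Γ D
      b-count   : ∀ (i : Fin (suc D)) {x y} → Distance Γ (toℕ i) x y →
                  #neighboursAt (suc (toℕ i)) x y ≡ lookup (bs ∷ʳ 0) i
      c-count   : ∀ (i : Fin D) {x y} → Distance Γ (suc (toℕ i)) x y →
                  #neighboursAt (toℕ i) x y ≡ lookup cs i

{-# OPTIONS --safe #-}
module Submission where

-- The local graph Δ has 80 vertices, is 25-regular, and nonadjacent vertices have at
-- most 5 common neighbours in it.  Let Free T be the set of vertices outside T and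
-- nonadjacent to all of T.  Inclusion-exclusion along a 5-coclique is tight: for a part
-- T of it with |T| = 2, 3, 4 one gets |Free T| = 33, 17, 6, and no vertex is adjacent to
-- three of its members.  Hence, if every w in Free {d, e} extends {d, e} to a 5-coclique,
-- the complement graph on Free {d, e} is 17-regular on 33 vertices, which violates
-- the handshake lemma.
--
-- Suppose some w in Free {d, e} does not extend.  Then w is adjacent to exactly two of
-- a, b, c, say to a and b.  Now K = Free {w, d, e} is a clique; it has at least
-- 33 - 17 - 5 = 11 vertices, because w and c have at most 5 common neighbours.
-- It is covered by its intersections with Free {a} and Free {b}, both of which contain
-- the 6 vertices of Free {a, b, d, e} and have at most 8 vertices each, by a double count
-- in the 17-vertex sets Free {a, d, e} and Free {b, d, e}.  So |K| ≤ 8 + 8 - 6 = 10.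

open import Defs
open import Algebra.Properties.CommutativeMonoid.Sum
open import Data.Bool using (true; false; if_then_else_)
open import Data.Empty using (⊥)
open import Data.Fin using (Fin; zero; suc)
open import Data.Fin.Patterns using (0F; 1F; 2F; 3F; 4F)
open import Data.Fin.Properties using (any?) renaming (_≟_ to _≟ᶠ_)
open import Data.List using (List; []; _∷_; length; filter; tabulate)
open import Data.List.Membership.Propositional.Properties using (∈-allFin; ∈-filter⁺; ∈-length)
open import Data.List.Relation.Binary.Permutation.Propositional using (_↭_; refl; prep; swap; trans)
open import Data.List.Relation.Binary.Permutation.Propositional.Properties using (All-resp-↭; ++-comm)
open import Data.List.Relation.Unary.All as All using (All; []; _∷_)
open import Data.Nat using (ℕ; zero; suc; _+_; _*_; _≤_; z≤n; s≤s)
open import Data.Nat.Divisibility using (_∣_; _∣?_; _∣0; divides; ∣m∣n⇒∣m+n)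
open import Data.Nat.Properties
open import Data.Nat.Tactic.RingSolver using (solve-∀)
open import Data.Product using (∃; ∃₂; _×_; _,_; proj₁; proj₂)
open import Data.Irrelevant using (Irrelevant; [_])
open import Data.Refinement using (Refinement-syntax; value; proof)
open import Data.Sum using (_⊎_; inj₁; inj₂; [_,_]′)
open import Data.Vec using (_∷_; [])
open import Function using (_∘_; case_of_; Injection)
open import Level using (0ℓ)
open import Relation.Binary.PropositionalEquality as ≡ using (_≡_; _≢_; refl; cong; cong₂; sym; subst)
open import Relation.Nullary using (¬_; Dec; yes; no; does; ¬?; _×-dec_; contradiction)
open import Relation.Nullary.Decidable using (from-no; decidable-stable; recompute)
open import Relation.Unary using (Pred; Decidable; _⊆_; ∅)
open import Relation.Unary.Properties using (∅?)

open ≤-Reasoning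

-- Finite sums of natural numbers and the parity of symmetric sums.

∑ : ∀ {n} → (Fin n → ℕ) → ℕ
∑ = sum +-0-commutativeMonoid

∑-mono : ∀ {n} {f g : Fin n → ℕ} → (∀ i → f i ≤ g i) → ∑ f ≤ ∑ g
∑-mono {zero}  f≤g = z≤n
∑-mono {suc n} f≤g = +-mono-≤ (f≤g zero) (∑-mono (f≤g ∘ suc))

∑-*ˡ : ∀ {n} k (f : Fin n → ℕ) → ∑ (λ i → k * f i) ≡ k * ∑ f
∑-*ˡ {zero}  k f = sym (*-zeroʳ k)
∑-*ˡ {suc n} k f = ≡.trans (cong (k * f zero +_) (∑-*ˡ k (f ∘ suc)))
                           (sym (*-distribˡ-+ k (f zero) _))

-- Peel off the first row and the first column: their common corner is zero and by symmetry the
-- remainders are equal, so together they contribute twice the row.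
∑∑-symmetric-even : ∀ {n} (f : Fin n → Fin n → ℕ) → (∀ i j → f i j ≡ f j i) →
                    (∀ i → f i i ≡ 0) → 2 ∣ ∑ (λ i → ∑ (f i))
∑∑-symmetric-even {zero}  f f-sym f-diag = 2 ∣0
∑∑-symmetric-even {suc n} f f-sym f-diag = subst (2 ∣_) (sym expand)
  (∣m∣n⇒∣m+n (divides row (*-comm 2 row))
             (∑∑-symmetric-even (λ i j → f (suc i) (suc j))
               (λ i j → f-sym (suc i) (suc j)) (f-diag ∘ suc)))
  where
  row  = ∑ (λ j → f zero (suc j))
  rest = ∑ (λ i → ∑ (λ j → f (suc i) (suc j)))
  rearranged : ∀ r s → 0 + r + (r + s) ≡ 2 * r + s
  rearranged = solve-∀
  expand : ∑ (λ i → ∑ (f i)) ≡ 2 * row + rest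
  expand = ≡.trans
    (cong₂ (λ d c → d + row + c) (f-diag zero)
      (≡.trans (∑-distrib-+ +-0-commutativeMonoid (λ i → f (suc i) zero) _)
               (cong (_+ rest) (sum-cong-≗ +-0-commutativeMonoid (λ i → f-sym (suc i) zero)))))
    (rearranged row rest)

-- Cardinalities of decidable sets and double counting.

𝟙 : {A : Set} → Dec A → ℕ
𝟙 A? = if does A? then 1 else 0

module _ {n : ℕ} where

  #≡∑ : {P : Pred (Fin n) 0ℓ} (P? : Decidable P) → # P? ≡ ∑ (𝟙 ∘ P?)
  #≡∑ {P} P? = go (λ i → i)
    where
    go : ∀ {m} (f : Fin m → Fin n) → length (filter P? (tabulate f)) ≡ ∑ (𝟙 ∘ P? ∘ f)
    go {zero}  f = refl
    go {suc m} f with does (P? (f zero))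
    ... | true  = cong suc (go (f ∘ suc))
    ... | false = go (f ∘ suc)

  #-positive : {P : Pred (Fin n) 0ℓ} (P? : Decidable P) → ∀ {v} → P v → 1 ≤ # P?
  #-positive P? {v} Pv = ∈-length (∈-filter⁺ P? (∈-allFin v) Pv)

  -- Checked vertex by vertex on indicators. With `Q` empty this becomes the union bound, and with
  -- `S` empty the bound for disjoint subsets of `R`; `K-≤` uses the full form.
  #-exchange : {P Q R S : Pred (Fin n) 0ℓ}
    (P? : Decidable P) (Q? : Decidable Q) (R? : Decidable R) (S? : Decidable S) →
    (∀ {v} → P v → R v ⊎ S v) → (∀ {v} → Q v → R v ⊎ S v) →
    (∀ {v} → P v → Q v → R v × S v) → # P? + # Q? ≤ # R? + # S?
  #-exchange P? Q? R? S? P⊆ Q⊆ P∩Q⊆ = begin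
    # P? + # Q?                      ≡⟨ cong₂ _+_ (#≡∑ P?) (#≡∑ Q?) ⟩
    ∑ (𝟙 ∘ P?) + ∑ (𝟙 ∘ Q?)          ≡⟨ ∑-distrib-+ +-0-commutativeMonoid (𝟙 ∘ P?) (𝟙 ∘ Q?) ⟨
    ∑ (λ v → 𝟙 (P? v) + 𝟙 (Q? v))    ≤⟨ ∑-mono pointwise ⟩
    ∑ (λ v → 𝟙 (R? v) + 𝟙 (S? v))    ≡⟨ ∑-distrib-+ +-0-commutativeMonoid (𝟙 ∘ R?) (𝟙 ∘ S?) ⟩
    ∑ (𝟙 ∘ R?) + ∑ (𝟙 ∘ S?)          ≡⟨ cong₂ _+_ (#≡∑ R?) (#≡∑ S?) ⟨
    # R? + # S?                      ∎
    where
    pointwise : ∀ v → 𝟙 (P? v) + 𝟙 (Q? v) ≤ 𝟙 (R? v) + 𝟙 (S? v)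
    pointwise v with P? v | Q? v | R? v | S? v
    ... | no _  | no _  | _     | _     = z≤n
    ... | yes _ | yes _ | yes _ | yes _ = ≤-refl
    ... | yes p | yes q | no ¬r | _     = contradiction (proj₁ (P∩Q⊆ p q)) ¬r
    ... | yes p | yes q | yes _ | no ¬s = contradiction (proj₂ (P∩Q⊆ p q)) ¬s
    ... | yes _ | no _  | yes _ | _     = s≤s z≤n
    ... | yes _ | no _  | no _  | yes _ = s≤s z≤n
    ... | yes p | no _  | no ¬r | no ¬s = contradiction (P⊆ p) [ ¬r , ¬s ]′
    ... | no _  | yes _ | yes _ | _     = s≤s z≤n
    ... | no _  | yes _ | no _  | yes _ = s≤s z≤n
    ... | no _  | yes q | no ¬r | no ¬s = contradiction (Q⊆ q) [ ¬r , ¬s ]′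

  ∅ᶠ? : Decidable {A = Fin n} ∅
  ∅ᶠ? = ∅?

  #∅ : # ∅ᶠ? ≡ 0
  #∅ = ≡.trans (#≡∑ ∅ᶠ?) (sum-replicate-zero +-0-commutativeMonoid n)

  #-∪ : {P Q R : Pred (Fin n) 0ℓ} (P? : Decidable P) (Q? : Decidable Q) (R? : Decidable R) →
        (∀ {v} → P v → Q v ⊎ R v) → # P? ≤ # Q? + # R?
  #-∪ P? Q? R? P⊆ = begin
    # P?         ≤⟨ m≤m+n _ _ ⟩
    # P? + # ∅ᶠ?  ≤⟨ #-exchange P? ∅ᶠ? Q? R? P⊆ (λ ()) (λ _ ()) ⟩
    # Q? + # R?  ∎

  #-disjoint : {P Q R : Pred (Fin n) 0ℓ} (P? : Decidable P) (Q? : Decidable Q) (R? : Decidable R) →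
               P ⊆ R → Q ⊆ R → (∀ {v} → P v → ¬ Q v) → # P? + # Q? ≤ # R?
  #-disjoint P? Q? R? P⊆ Q⊆ disj = begin
    # P? + # Q?  ≤⟨ #-exchange P? Q? R? ∅ᶠ? (inj₁ ∘ P⊆) (inj₁ ∘ Q⊆) (λ p q → contradiction q (disj p)) ⟩
    # R? + # ∅ᶠ?  ≡⟨ cong (# R? +_) #∅ ⟩
    # R? + 0     ≡⟨ +-identityʳ _ ⟩
    # R?         ∎

  #-mono : {P Q : Pred (Fin n) 0ℓ} (P? : Decidable P) (Q? : Decidable Q) → P ⊆ Q → # P? ≤ # Q?
  #-mono P? Q? P⊆ = ≤-trans (m≤m+n _ _) (#-disjoint P? ∅ᶠ? Q? P⊆ (λ ()) (λ _ ()))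

  #-cong : {P Q : Pred (Fin n) 0ℓ} (P? : Decidable P) (Q? : Decidable Q) → P ⊆ Q → Q ⊆ P → # P? ≡ # Q?
  #-cong P? Q? P⊆Q Q⊆P = ≤-antisym (#-mono P? Q? P⊆Q) (#-mono Q? P? Q⊆P)

  #-remove : {P Q : Pred (Fin n) 0ℓ} (P? : Decidable P) (Q? : Decidable Q) → ∀ {v} →
             P ⊆ Q → Q v → ¬ P v → # P? + 1 ≤ # Q?
  #-remove {P} {Q} P? Q? {v} P⊆Q Qv ¬Pv = begin
    # P? + 1            ≤⟨ +-monoʳ-≤ (# P?) (#-positive (v ≟ᶠ_) refl) ⟩
    # P? + # (v ≟ᶠ_)    ≤⟨ #-disjoint P? (v ≟ᶠ_) Q? P⊆Q (λ { refl → Qv }) (λ { Pv refl → ¬Pv Pv }) ⟩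
    # Q?                ∎

  -- Proving a bound may need a member of the set as a witness. The empty set satisfies every bound,
  -- so such a member may be assumed.
  #-≤-inhabited : {P : Pred (Fin n) 0ℓ} (P? : Decidable P) → ∀ {m} → (∀ v → P v → # P? ≤ m) → # P? ≤ m
  #-≤-inhabited P? bound with any? P?
  ... | yes (v , Pv) = bound v Pv
  ... | no ∄         = ≤-trans (#-mono P? ∅ᶠ? (λ Pv → ∄ (_ , Pv))) (≤-trans (≤-reflexive #∅) z≤n)

  module _ {P : Pred (Fin n) 0ℓ} (P? : Decidable P)
           {S : Fin n → Pred (Fin n) 0ℓ} (S? : ∀ p → Decidable (S p)) (d : ℕ) where

    *-#≤∑ : (∀ {p} → P p → d ≤ # (S? p)) → d * # P? ≤ ∑ (λ p → # (S? p))
    *-#≤∑ d≤ = begin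
      d * # P?                 ≡⟨ cong (d *_) (#≡∑ P?) ⟩
      d * ∑ (𝟙 ∘ P?)           ≡⟨ ∑-*ˡ d (𝟙 ∘ P?) ⟨
      ∑ (λ p → d * 𝟙 (P? p))   ≤⟨ ∑-mono pointwise ⟩
      ∑ (λ p → # (S? p))       ∎
      where
      pointwise : ∀ p → d * 𝟙 (P? p) ≤ # (S? p)
      pointwise p with P? p
      ... | yes Pp = ≤-trans (≤-reflexive (*-identityʳ d)) (d≤ Pp)
      ... | no _   = ≤-trans (≤-reflexive (*-zeroʳ d)) z≤n

    ∑≤*-# : (∀ {p} → P p → # (S? p) ≤ d) → (∀ {p q} → S p q → P p) → ∑ (λ p → # (S? p)) ≤ d * # P?
    ∑≤*-# ≤d S⊆P = begin
      ∑ (λ p → # (S? p))       ≤⟨ ∑-mono pointwise ⟩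
      ∑ (λ p → d * 𝟙 (P? p))   ≡⟨ ∑-*ˡ d (𝟙 ∘ P?) ⟩
      d * ∑ (𝟙 ∘ P?)           ≡⟨ cong (d *_) (#≡∑ P?) ⟨
      d * # P?                 ∎
      where
      pointwise : ∀ p → # (S? p) ≤ d * 𝟙 (P? p)
      pointwise p with P? p
      ... | yes Pp = ≤-trans (≤d Pp) (≤-reflexive (sym (*-identityʳ d)))
      ... | no ¬Pp = ≤-trans (≤-trans (#-mono (S? p) ∅ᶠ? (¬Pp ∘ S⊆P)) (≤-reflexive #∅)) z≤n

  module _ {S : Fin n → Pred (Fin n) 0ℓ} (S? : ∀ p → Decidable (S p)) where

    ∑#-comm : ∑ (λ p → # (S? p)) ≡ ∑ (λ q → # (λ p → S? p q))
    ∑#-comm = begin-equality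
      ∑ (λ p → # (S? p))              ≡⟨ sum-cong-≗ +-0-commutativeMonoid (λ p → #≡∑ (S? p)) ⟩
      ∑ (λ p → ∑ (λ q → 𝟙 (S? p q)))  ≡⟨ ∑-comm +-0-commutativeMonoid (λ p q → 𝟙 (S? p q)) ⟩
      ∑ (λ q → ∑ (λ p → 𝟙 (S? p q)))  ≡⟨ sum-cong-≗ +-0-commutativeMonoid (λ q → #≡∑ (λ p → S? p q)) ⟨
      ∑ (λ q → # (λ p → S? p q))      ∎

    handshake : (∀ {p q} → S p q → S q p) → (∀ {p} → ¬ S p p) → 2 ∣ ∑ (λ p → # (S? p))
    handshake S-sym S-irrefl = subst (2 ∣_)
      (sym (sum-cong-≗ +-0-commutativeMonoid (λ p → #≡∑ (S? p))))
      (∑∑-symmetric-even (λ p q → 𝟙 (S? p q)) indicator-sym indicator-diag)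
      where
      indicator-sym : ∀ p q → 𝟙 (S? p q) ≡ 𝟙 (S? q p)
      indicator-sym p q with S? p q | S? q p
      ... | yes _ | yes _ = refl
      ... | no _  | no _  = refl
      ... | yes s | no ¬s = contradiction (S-sym s) ¬s
      ... | no ¬s | yes s = contradiction (S-sym s) ¬s
      indicator-diag : ∀ p → 𝟙 (S? p p) ≡ 0
      indicator-diag p with S? p p
      ... | yes s = contradiction s S-irrefl
      ... | no _  = refl

-- Nonadjacency, free vertices and cocliques in the local graph.

module LocalGraph {n : ℕ} (Γ : Graph (Fin n)) (x : Fin n) where
  open Graph Γ

  infix 4 _∥_ _∥?_

  -- Adjacency in the complement graph. Distinctness is included so that `Free T` omits the members
  -- of `T`.
  _∥_ : Fin n → Fin n → Set
  u ∥ v = u ≢ v × ¬ u ~ v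

  _∥?_ : ∀ u v → Dec (u ∥ v)
  u ∥? v = ¬? (u ≟ᶠ v) ×-dec ¬? (u ~? v)

  ∥-sym : ∀ {u v} → u ∥ v → v ∥ u
  ∥-sym (u≢v , u≁v) = u≢v ∘ sym , u≁v ∘ ~-sym

  Common : Fin n → Fin n → Pred (Fin n) 0ℓ
  Common s t v = x ~ v × s ~ v × t ~ v

  common? : ∀ s t → Decidable (Common s t)
  common? s t v = (x ~? v) ×-dec (s ~? v) ×-dec (t ~? v)

  Free : List (Fin n) → Pred (Fin n) 0ℓ
  Free T v = x ~ v × All (_∥ v) T

  free? : ∀ T → Decidable (Free T)
  free? T v = (x ~? v) ×-dec All.all? (_∥? v) T

  Attached : Fin n → List (Fin n) → Pred (Fin n) 0ℓ
  Attached s T v = s ~ v × Free T v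

  attached? : ∀ s T → Decidable (Attached s T)
  attached? s T v = (s ~? v) ×-dec free? T v

  free-∷ : ∀ {t T v} → t ∥ v → Free T v → Free (t ∷ T) v
  free-∷ t∥v (x~v , T∥v) = x~v , t∥v ∷ T∥v

  free-tail : ∀ {t T v} → Free (t ∷ T) v → Free T v
  free-tail (x~v , _ ∷ T∥v) = x~v , T∥v

  free-resp-↭ : ∀ {S T} → S ↭ T → Free S ⊆ Free T
  free-resp-↭ S↭T (x~v , S∥v) = x~v , All-resp-↭ S↭T S∥v

  -- Each vertex is compared only with the later entries, so tails of a coclique are cocliques at
  -- once and new vertices can be put in front. Other orders come from `independent-resp-↭`.
  data Independent : List (Fin n) → Set where
    []  : Independent []
    _∷_ : ∀ {s T} → Free T s → Independent T → Independent (s ∷ T)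

  independent-head : ∀ {s T} → Independent (s ∷ T) → Free T s
  independent-head (f ∷ _) = f

  independent-tail : ∀ {s T} → Independent (s ∷ T) → Independent T
  independent-tail (_ ∷ I) = I

  independent-resp-↭ : ∀ {S T} → S ↭ T → Independent S → Independent T
  independent-resp-↭ refl          I       = I
  independent-resp-↭ (prep _ S↭T)  (f ∷ I) = free-resp-↭ S↭T f ∷ independent-resp-↭ S↭T I
  independent-resp-↭ (swap _ _ S↭T) ((x~a , b∥a ∷ S∥a) ∷ fb ∷ I) =
    free-∷ (∥-sym b∥a) (free-resp-↭ S↭T fb) ∷ free-resp-↭ S↭T (x~a , S∥a) ∷ independent-resp-↭ S↭T I
  independent-resp-↭ (trans p q)   I       = independent-resp-↭ q (independent-resp-↭ p I)

  -- All that the argument takes from the intersection array: 80 = b₀, 25 = b₀ - b₁ - c₁ and 5 = c₂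
  -- - 1.
  record Parameters : Set where
    field
      order   : # (x ~?_) ≡ 80
      valency : ∀ {s} → x ~ s → # (λ v → (x ~? v) ×-dec (s ~? v)) ≡ 25
      common  : ∀ {s t} → x ~ s → x ~ t → s ∥ t → # (common? s t) ≤ 5

  -- Inclusion-exclusion bounds for free sets.

  module _ (parameters : Parameters) where
    open Parameters parameters

    free-[] : # (free? []) ≡ 80
    free-[] = ≡.trans (#-cong (free? []) (x ~?_) proj₁ (λ x~v → x~v , [])) order

    attached-∷ : ∀ {s t T} → x ~ s → x ~ t → t ∥ s → # (attached? s T) ≤ # (attached? s (t ∷ T)) + 5
    attached-∷ {s} {t} {T} x~s x~t t∥s = begin
      # (attached? s T)                              ≤⟨ #-∪ (attached? s T) (attached? s (t ∷ T)) (common? s t) split ⟩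
      # (attached? s (t ∷ T)) + # (common? s t)      ≤⟨ +-monoʳ-≤ _ (common x~s x~t (∥-sym t∥s)) ⟩
      # (attached? s (t ∷ T)) + 5                    ∎
      where
      split : ∀ {v} → Attached s T v → Attached s (t ∷ T) v ⊎ Common s t v
      split {v} (s~v , f) with t ~? v
      ... | yes t~v = inj₂ (proj₁ f , s~v , t~v)
      -- `t ∥ v` also requires `t ≢ v`, which holds because `s` is adjacent to `v` but not to `t`.
      ... | no t≁v  = inj₁ (s~v , free-∷ ((λ { refl → proj₂ t∥s (~-sym s~v) }) , t≁v) f)

    -- A common neighbour w of s and t that also meets T has already been discarded
    -- from Attached s T, so only four of the five common neighbours are still lost.
    attached-∷-strict : ∀ {s t T w} → x ~ s → x ~ t → t ∥ s → Common s t w → ¬ Free T w →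
                        # (attached? s T) + 1 ≤ # (attached? s (t ∷ T)) + 5
    attached-∷-strict {s} {t} {T} {w} x~s x~t t∥s cw w∉ = begin
      # (attached? s T) + 1                     ≤⟨ +-monoˡ-≤ 1 (#-∪ (attached? s T) (attached? s (t ∷ T)) others? split) ⟩
      # (attached? s (t ∷ T)) + # others? + 1   ≡⟨ +-assoc (# (attached? s (t ∷ T))) _ 1 ⟩
      # (attached? s (t ∷ T)) + (# others? + 1) ≤⟨ +-monoʳ-≤ _ (#-remove others? (common? s t) proj₁ cw (λ (_ , w≢w) → w≢w refl)) ⟩
      # (attached? s (t ∷ T)) + # (common? s t) ≤⟨ +-monoʳ-≤ _ (common x~s x~t (∥-sym t∥s)) ⟩
      # (attached? s (t ∷ T)) + 5               ∎
      where
      others? : Decidable (λ v → Common s t v × v ≢ w)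
      others? v = common? s t v ×-dec ¬? (v ≟ᶠ w)
      split : ∀ {v} → Attached s T v → Attached s (t ∷ T) v ⊎ (Common s t v × v ≢ w)
      split {v} (s~v , f) with t ~? v
      ... | yes t~v = inj₂ ((proj₁ f , s~v , t~v) , λ { refl → w∉ f })
      ... | no t≁v  = inj₁ (s~v , free-∷ ((λ { refl → proj₂ t∥s (~-sym s~v) }) , t≁v) f)

    attached-[] : ∀ {s} → x ~ s → 25 ≤ # (attached? s [])
    attached-[] {s} x~s = begin
      25                                  ≡⟨ valency x~s ⟨
      # (λ v → (x ~? v) ×-dec (s ~? v))   ≤⟨ #-mono (λ v → (x ~? v) ×-dec (s ~? v)) (attached? s []) (λ (x~v , s~v) → s~v , x~v , []) ⟩
      # (attached? s [])                  ∎

    -- Each member of `T` takes away at most 5 of the 25 neighbours of `s`, namely its common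
    -- neighbours with `s`.
    attached-bound : ∀ {s T} → Free T s → Independent T → 25 ≤ # (attached? s T) + length T * 5
    attached-bound {s} (x~s , []) [] = ≤-trans (attached-[] x~s) (m≤m+n _ 0)
    attached-bound {s} {t ∷ T} (x~s , t∥s ∷ T∥s) (t-free ∷ I) = begin
      25                                              ≤⟨ attached-bound (x~s , T∥s) I ⟩
      # (attached? s T) + length T * 5                ≤⟨ +-monoˡ-≤ _ (attached-∷ x~s (proj₁ t-free) t∥s) ⟩
      # (attached? s (t ∷ T)) + 5 + length T * 5      ≡⟨ +-assoc (# (attached? s (t ∷ T))) 5 _ ⟩
      # (attached? s (t ∷ T)) + (5 + length T * 5)    ∎

    -- Passing from `T` to `s ∷ T` discards `s` itself, which is the summand 1, and the neighbours
    -- of `s` in `Free T`.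
    free-step : ∀ {s T} → Free T s → # (free? (s ∷ T)) + 1 + # (attached? s T) ≤ # (free? T)
    free-step {s} {T} f = begin
      # (free? (s ∷ T)) + 1 + # (attached? s T) ≤⟨ +-monoˡ-≤ _ (#-remove (free? (s ∷ T)) rest?
                                                     (λ { (x~v , s∥v ∷ T∥v) → (x~v , T∥v) , proj₂ s∥v })
                                                     (f , ~-irrefl refl) λ { (_ , s∥s ∷ _) → proj₁ s∥s refl }) ⟩
      # rest? + # (attached? s T)               ≤⟨ #-disjoint rest? (attached? s T) (free? T) proj₁ proj₂ (λ (_ , s≁v) (s~v , _) → s≁v s~v) ⟩
      # (free? T)                               ∎
      where
      rest? : Decidable (λ v → Free T v × ¬ s ~ v)
      rest? v = free? T v ×-dec ¬? (s ~? v)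

    -- Here 26 counts `s` and its 25 neighbours. The inequality is used in both directions: for
    -- upper bounds as the coclique grows from the empty one, and for lower bounds as it shrinks
    -- from five vertices.
    free-∷-bound : ∀ {s T} → Independent (s ∷ T) → # (free? (s ∷ T)) + 26 ≤ # (free? T) + length T * 5
    free-∷-bound {s} {T} (f ∷ I) = begin
      # (free? (s ∷ T)) + 26                                       ≡⟨ +-assoc (# (free? (s ∷ T))) 1 25 ⟨
      # (free? (s ∷ T)) + 1 + 25                                   ≤⟨ +-monoʳ-≤ (# (free? (s ∷ T)) + 1) (attached-bound f I) ⟩
      # (free? (s ∷ T)) + 1 + (# (attached? s T) + length T * 5)   ≡⟨ +-assoc (# (free? (s ∷ T)) + 1) _ _ ⟨
      # (free? (s ∷ T)) + 1 + # (attached? s T) + length T * 5     ≤⟨ +-monoˡ-≤ _ (free-step f) ⟩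
      # (free? T) + length T * 5                                   ∎

    free₁-≤ : ∀ {e} → Independent (e ∷ []) → # (free? (e ∷ [])) ≤ 54
    free₁-≤ {e} I = +-cancelʳ-≤ 26 _ 54 (begin
      # (free? (e ∷ [])) + 26   ≤⟨ free-∷-bound I ⟩
      # (free? []) + 0          ≡⟨ +-identityʳ _ ⟩
      # (free? [])              ≡⟨ free-[] ⟩
      80                        ∎)

    free₂-≤ : ∀ {d e} → Independent (d ∷ e ∷ []) → # (free? (d ∷ e ∷ [])) ≤ 33
    free₂-≤ I@(_ ∷ I₁) = +-cancelʳ-≤ 26 _ 33 (≤-trans (free-∷-bound I) (+-monoˡ-≤ 5 (free₁-≤ I₁)))

    free₃-≤ : ∀ {c d e} → Independent (c ∷ d ∷ e ∷ []) → # (free? (c ∷ d ∷ e ∷ [])) ≤ 17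
    free₃-≤ I@(_ ∷ I₂) = +-cancelʳ-≤ 26 _ 17 (≤-trans (free-∷-bound I) (+-monoˡ-≤ 10 (free₂-≤ I₂)))

    free₄-≤ : ∀ {b c d e} → Independent (b ∷ c ∷ d ∷ e ∷ []) → # (free? (b ∷ c ∷ d ∷ e ∷ [])) ≤ 6
    free₄-≤ I@(_ ∷ I₃) = +-cancelʳ-≤ 26 _ 6 (≤-trans (free-∷-bound I) (+-monoˡ-≤ 15 (free₃-≤ I₃)))

    -- Exact counts in the presence of a 5-coclique, and a clique bound.

    module _ {a b c d e : Fin n} (I₅ : Independent (a ∷ b ∷ c ∷ d ∷ e ∷ [])) where

      private
        I₄ : Independent (b ∷ c ∷ d ∷ e ∷ [])
        I₄ = independent-tail I₅

        I₃ : Independent (c ∷ d ∷ e ∷ [])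
        I₃ = independent-tail I₄

        I₂ : Independent (d ∷ e ∷ [])
        I₂ = independent-tail I₃

      -- Start from the trivial bound 0 for the set free of all five vertices. Going back with the
      -- corrections 20, 15 and 10 yields 6, 17 and 33, which are exactly the upper bounds.
      free₄-≥ : 6 ≤ # (free? (b ∷ c ∷ d ∷ e ∷ []))
      free₄-≥ = +-cancelʳ-≤ 20 6 _ (≤-trans (m≤n+m 26 _) (free-∷-bound I₅))

      free₃-≥ : 17 ≤ # (free? (c ∷ d ∷ e ∷ []))
      free₃-≥ = +-cancelʳ-≤ 15 17 _ (≤-trans (+-monoˡ-≤ 26 free₄-≥) (free-∷-bound I₄))

      free₂-≥ : 33 ≤ # (free? (d ∷ e ∷ []))
      free₂-≥ = +-cancelʳ-≤ 10 33 _ (≤-trans (+-monoˡ-≤ 26 free₃-≥) (free-∷-bound I₃))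

      free₄-# : # (free? (b ∷ c ∷ d ∷ e ∷ [])) ≡ 6
      free₄-# = ≤-antisym (free₄-≤ I₄) free₄-≥

      free₃-# : # (free? (c ∷ d ∷ e ∷ [])) ≡ 17
      free₃-# = ≤-antisym (free₃-≤ I₃) free₃-≥

      free₂-# : # (free? (d ∷ e ∷ [])) ≡ 33
      free₂-# = ≤-antisym (free₂-≤ I₂) free₂-≥

      -- Since `w` is shared, `d` and `e` together take at most 9 of the 25 neighbours of `c`. Then
      -- `c` keeps 16 neighbours in Free {d, e}, and 17 + 1 + 16 exceeds 33. Other triples of the
      -- coclique are reached by permuting it.
      no-triple : ∀ {w} → x ~ w → c ~ w → d ~ w → ¬ e ~ w
      no-triple {w} x~w c~w d~w e~w with I₃
      ... | c-free@(x~c , d∥c ∷ e∥c ∷ []) ∷ (x~d , _) ∷ (x~e , _) ∷ [] = <-irrefl refl (begin-strict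
        33                  <⟨ +-mono-≤ (+-monoˡ-≤ 1 free₃-≥) attached-≥ ⟩
        F + 1 + A           ≤⟨ free-step c-free ⟩
        # (free? (d ∷ e ∷ []))  ≡⟨ free₂-# ⟩
        33                  ∎)
        where
        F = # (free? (c ∷ d ∷ e ∷ []))
        A = # (attached? c (d ∷ e ∷ []))
        attached-≥ : 16 ≤ A
        attached-≥ = +-cancelʳ-≤ 10 16 A (begin
          26                                   ≤⟨ +-monoˡ-≤ 1 (attached-[] x~c) ⟩
          # (attached? c []) + 1               ≤⟨ +-monoˡ-≤ 1 (attached-∷ x~c x~e e∥c) ⟩
          # (attached? c (e ∷ [])) + 5 + 1     ≡⟨ +-assoc (# (attached? c (e ∷ []))) 5 1 ⟩
          # (attached? c (e ∷ [])) + (1 + 5)   ≡⟨ +-assoc (# (attached? c (e ∷ []))) 1 5 ⟨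
          # (attached? c (e ∷ [])) + 1 + 5     ≤⟨ +-monoˡ-≤ 5 (attached-∷-strict x~c x~d d∥c (x~w , c~w , d~w)
                                                    (λ { (_ , e∥w ∷ []) → proj₂ e∥w e~w })) ⟩
          A + 5 + 5                            ≡⟨ +-assoc A 5 5 ⟩
          A + 10                               ∎)

    -- In the complement graph on Free T all degrees are at most 6, and equal to 6 on K,
    -- so double counting the non-edges between K and Free T ∖ K gives |K| ≤ 17 - |K|.
    clique-bound : ∀ {T} → # (free? T) ≡ 17 →
      (∀ {u v} → Free T u → Free (u ∷ T) v → # (free? (u ∷ T)) ≡ 6) →
      {K : Pred (Fin n) 0ℓ} (K? : Decidable K) → K ⊆ Free T →
      (∀ {u v} → K u → K v → ¬ u ∥ v) → (∀ {u} → K u → ∃ (Free (u ∷ T))) → # K? ≤ 8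
    clique-bound {T} ≡17 ≡6 {K} K? K⊆ K-clique K-defect = ≮⇒≥ λ 9≤#K → <-irrefl refl (begin-strict
      17                <⟨ +-mono-≤ 9≤#K (≤-trans 9≤#K #K≤#rest) ⟩
      # K? + # rest?    ≤⟨ #-disjoint K? rest? (free? T) K⊆ proj₁ (λ Kv (_ , ¬Kv) → ¬Kv Kv) ⟩
      # (free? T)       ≡⟨ ≡17 ⟩
      17                ∎)
      where
      rest? : Decidable (λ v → Free T v × ¬ K v)
      rest? v = free? T v ×-dec ¬? (K? v)
      crossing? : ∀ u → Decidable (λ v → K u × (Free T v × ¬ K v) × u ∥ v)
      crossing? u v = K? u ×-dec rest? v ×-dec (u ∥? v)
      from-K : ∀ {u} → K u → 6 ≤ # (crossing? u)
      from-K {u} Ku = begin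
        6                    ≡⟨ ≡6 (K⊆ Ku) (proj₂ (K-defect Ku)) ⟨
        # (free? (u ∷ T))    ≤⟨ #-mono (free? (u ∷ T)) (crossing? u)
                                  (λ { (x~v , u∥v ∷ T∥v) → Ku , ((x~v , T∥v) , λ Kv → K-clique Ku Kv u∥v) , u∥v }) ⟩
        # (crossing? u)      ∎
      into-rest : ∀ {v} → Free T v × ¬ K v → # (λ u → crossing? u v) ≤ 6
      -- Any `u` in the counted set is a nonneighbour of `v` in `Free T`, which is the witness that
      -- `≡6` asks for at `v`.
      into-rest {v} (v-free , _) = #-≤-inhabited (λ u → crossing? u v) λ u (Ku , _ , u∥v) → begin
        # (λ u → crossing? u v)  ≤⟨ #-mono (λ u → crossing? u v) (free? (v ∷ T)) (λ (Ku , _ , u∥v) → free-∷ (∥-sym u∥v) (K⊆ Ku)) ⟩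
        # (free? (v ∷ T))        ≡⟨ ≡6 v-free (free-∷ (∥-sym u∥v) (K⊆ Ku)) ⟩
        6                        ∎
      #K≤#rest : # K? ≤ # rest?
      #K≤#rest = *-cancelˡ-≤ 6 (begin
        6 * # K?                             ≤⟨ *-#≤∑ K? crossing? 6 from-K ⟩
        ∑ (λ u → # (crossing? u))            ≡⟨ ∑#-comm crossing? ⟩
        ∑ (λ v → # (λ u → crossing? u v))    ≤⟨ ∑≤*-# rest? (λ v u → crossing? u v) 6 into-rest (λ (_ , r , _) → r) ⟩
        6 * # rest?                          ∎)

    -- Vertices that do not extend a pair to a 5-coclique.

    ∦⇒~ : ∀ {u v} → u ≢ v → ¬ u ∥ v → u ~ v
    ∦⇒~ {u} {v} u≢v ∦ = decidable-stable (u ~? v) (λ u≁v → ∦ (u≢v , u≁v))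

    -- The two witnesses complete `w ∷ T` to a larger coclique. When `T` is a pair this is a
    -- 5-coclique, so the exact counts become available for `w ∷ T`.
    Extends : List (Fin n) → Fin n → Set
    Extends T w = ∃₂ λ u v → Free (w ∷ T) u × Free (u ∷ w ∷ T) v

    extends? : ∀ T w → Dec (Extends T w)
    extends? T w = any? λ u → any? λ v → free? (w ∷ T) u ×-dec free? (u ∷ w ∷ T) v

    extends : ∀ {u v w T} → Independent (v ∷ u ∷ w ∷ T) → Extends T w
    extends (v-free ∷ u-free ∷ _) = _ , _ , u-free , v-free

    module _ {a b c d e w : Fin n} (I : Independent (a ∷ b ∷ c ∷ d ∷ e ∷ []))
             (w-free : Free (d ∷ e ∷ []) w) (stuck : ¬ Extends (d ∷ e ∷ []) w) where

      -- If `w` were nonadjacent to both, then `a` and `b` would complete {w, d, e}. If `w` is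
      -- itself `a` or `b`, the remaining vertices of the given coclique do so.
      adjacent-to-one : a ~ w ⊎ b ~ w
      adjacent-to-one with a ~? w | b ~? w
      ... | yes a~w | _       = inj₁ a~w
      ... | no _    | yes b~w = inj₂ b~w
      ... | no a≁w  | no b≁w  with a ≟ᶠ w | b ≟ᶠ w
      ... | yes refl | _        = contradiction (extends
              (independent-resp-↭ (trans (swap a b refl) (trans (prep b (swap a c refl)) (swap b c refl))) I)) stuck
      ... | no _     | yes refl = contradiction (extends
              (independent-resp-↭ (prep a (swap b c refl)) I)) stuck
      ... | no a≢w   | no b≢w   = contradiction
              (b , a , free-∷ (∥-sym (b≢w , b≁w)) (free-tail b-free)
                     , free-∷ b∥a (free-∷ (∥-sym (a≢w , a≁w)) (free-tail (free-tail a-free)))) stuck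
        where
        a-free = independent-head I
        b∥a    = All.head (proj₂ a-free)
        b-free = independent-head (independent-tail I)

      module _ (b~w : b ~ w) (c∥w : c ∥ w) where

        nonneighbours-clique : ∀ {u v} → Free (w ∷ d ∷ e ∷ []) u → Free (w ∷ d ∷ e ∷ []) v → ¬ u ∥ v
        nonneighbours-clique u-free v-free u∥v = stuck (_ , _ , u-free , free-∷ u∥v v-free)

        half? : Decidable (λ v → Free (w ∷ d ∷ e ∷ []) v × b ∥ v)
        half? v = free? (w ∷ d ∷ e ∷ []) v ×-dec (b ∥? v)

        c-free-of-w : Free (w ∷ d ∷ e ∷ []) c
        c-free-of-w = free-∷ (∥-sym c∥w) (independent-head (independent-tail (independent-tail I)))

        -- `clique-bound` applies inside Free {b, d, e} once every `u` in the set has a nonneighbour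
        -- there. Otherwise `u` would be adjacent to all 6 vertices of Free {b, c, d, e}; so is `w`,
        -- because a nonneighbour of `w` among them would lie in the clique Free {w, d, e} together
        -- with `c`, to which it is not adjacent. But `u` and `w` have at most 5 common neighbours.
        half-bound : # half? ≤ 8
        half-bound = clique-bound {b ∷ d ∷ e ∷ []}
          (free₃-# (independent-resp-↭ (prep a (swap b c refl)) I))
          (λ u-free v-free → free₄-# (v-free ∷ u-free ∷ tail₃))
          half? (λ (v-free , b∥v) → free-∷ b∥v (free-tail v-free))
          (λ (u-free , _) (v-free , _) → nonneighbours-clique u-free v-free)
          (λ {u} (u-free , b∥u) → case any? (free? (u ∷ b ∷ d ∷ e ∷ [])) of λ where
            (yes defect) → defect
            (no ∄)       → contradiction (too-many-common u-free ∄) (<-irrefl refl))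
          where
          tail₃ : Independent (b ∷ d ∷ e ∷ [])
          tail₃ = independent-tail (independent-tail (independent-resp-↭ (prep a (swap b c refl)) I))
          too-many-common : ∀ {u} → Free (w ∷ d ∷ e ∷ []) u → ¬ ∃ (Free (u ∷ b ∷ d ∷ e ∷ [])) → 6 ≤ 5
          too-many-common {u} u-free@(x~u , w∥u ∷ _) ∄ = begin
            6                                ≤⟨ free₄-≥ I ⟩
            # (free? (b ∷ c ∷ d ∷ e ∷ []))   ≤⟨ #-mono (free? (b ∷ c ∷ d ∷ e ∷ [])) (common? u w) all-common ⟩
            # (common? u w)                  ≤⟨ common x~u (proj₁ w-free) (∥-sym w∥u) ⟩
            5                                ∎
            where
            all-common : ∀ {s} → Free (b ∷ c ∷ d ∷ e ∷ []) s → Common u w s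
            all-common {s} (x~s , b∥s ∷ c∥s ∷ de∥s) =
              x~s ,
              ∦⇒~ (λ { refl → nonneighbours-clique c-free-of-w u-free c∥s }) (λ u∥s → ∄ (s , x~s , u∥s ∷ b∥s ∷ de∥s)) ,
              ∦⇒~ (λ { refl → proj₂ b∥s b~w }) (λ w∥s → nonneighbours-clique c-free-of-w (x~s , w∥s ∷ de∥s) c∥s)

    -- A stuck vertex with two neighbours in the coclique is impossible.

    module _ {a b c d e w : Fin n} (I : Independent (a ∷ b ∷ c ∷ d ∷ e ∷ []))
             (w-free : Free (d ∷ e ∷ []) w) (stuck : ¬ Extends (d ∷ e ∷ []) w)
             (a~w : a ~ w) (b~w : b ~ w) where

      private
        D : List (Fin n)
        D = d ∷ e ∷ []

        c≁w : ¬ c ~ w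
        c≁w = no-triple (independent-resp-↭ (++-comm (a ∷ b ∷ c ∷ []) D) I) (proj₁ w-free) a~w b~w

        c-free : Free D c
        c-free = independent-head (independent-tail (independent-tail I))

        c∥a : c ∥ a
        c∥a = All.head (All.tail (proj₂ (independent-head I)))

        c∥w : c ∥ w
        c∥w = (λ { refl → proj₂ c∥a (~-sym a~w) }) , c≁w

        I′ : Independent (b ∷ a ∷ c ∷ D)
        I′ = independent-resp-↭ (swap a b refl) I

        I″ : Independent (c ∷ a ∷ b ∷ D)
        I″ = independent-resp-↭ (trans (prep a (swap b c refl)) (swap a c refl)) I

        K? = free? (w ∷ D)
        Ka? = half? I′ w-free stuck a~w c∥w
        Kb? = half? I w-free stuck b~w c∥w

        ¬c∥K : ∀ {v} → Free (w ∷ D) v → ¬ c ∥ v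
        ¬c∥K = nonneighbours-clique I w-free stuck b~w c∥w (free-∷ (∥-sym c∥w) c-free)

        -- A vertex of the clique missed by both parts is adjacent to `a` and `b`. It is also
        -- adjacent to `c`, which lies in the same clique, and this contradicts `no-triple`.
        K-covered : ∀ {v} → Free (w ∷ D) v → (Free (w ∷ D) v × a ∥ v) ⊎ (Free (w ∷ D) v × b ∥ v)
        K-covered {v} v-free@(x~v , w∥v ∷ _) with a ∥? v | b ∥? v
        ... | yes a∥v | _       = inj₁ (v-free , a∥v)
        ... | no _    | yes b∥v = inj₂ (v-free , b∥v)
        ... | no ¬a∥v | no ¬b∥v = contradiction c~v
                (no-triple (independent-resp-↭ (++-comm (a ∷ b ∷ c ∷ []) D) I) x~v a~v b~v)
          where
          a~v = ∦⇒~ (λ { refl → proj₂ w∥v (~-sym a~w) }) ¬a∥v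
          b~v = ∦⇒~ (λ { refl → proj₂ w∥v (~-sym b~w) }) ¬b∥v
          c~v = ∦⇒~ (λ { refl → proj₂ c∥a (~-sym a~v) }) (¬c∥K v-free)

        -- The vertices `s`, `a`, `b`, `d`, `e` form a 5-coclique, and `w` is already adjacent to
        -- `a` and `b`; `no-triple` rules out `s` as a third neighbour.
        w∥S : ∀ {s} → Free (a ∷ b ∷ D) s → w ∥ s
        w∥S {s} s-free@(x~s , a∥s ∷ _) = (λ { refl → proj₂ a∥s a~w }) , λ w~s →
          no-triple (independent-resp-↭ (++-comm (s ∷ a ∷ b ∷ []) D) (s-free ∷ independent-tail I″))
            (proj₁ w-free) (~-sym w~s) a~w b~w

        rest? : Decidable (λ v → Free D v × ¬ w ∥ v)
        rest? v = free? D v ×-dec ¬? (w ∥? v)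

        -- A vertex of Free {d, e} outside the clique is one of the 17 in Free {c, d, e} or one of
        -- at most 5 common neighbours of `c` and `w`; hence 22. The vertex `w` falls under the
        -- first case.
        K-≥ : 33 ≤ # K? + 22
        K-≥ = begin
          33                                               ≡⟨ free₂-# I ⟨
          # (free? D)                                      ≤⟨ #-∪ (free? D) K? rest? K-or-rest ⟩
          # K? + # rest?                                   ≤⟨ +-monoʳ-≤ (# K?) (#-∪ rest? (free? (c ∷ D)) (common? c w) rest-covered) ⟩
          # K? + (# (free? (c ∷ D)) + # (common? c w))     ≤⟨ +-monoʳ-≤ (# K?) (+-mono-≤ (≤-reflexive (free₃-# I))
                                                                (common (proj₁ c-free) (proj₁ w-free) c∥w)) ⟩
          # K? + 22                                        ∎
          where
          K-or-rest : ∀ {v} → Free D v → Free (w ∷ D) v ⊎ (Free D v × ¬ w ∥ v)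
          K-or-rest {v} v-free with w ∥? v
          ... | yes w∥v = inj₁ (free-∷ w∥v v-free)
          ... | no ¬w∥v = inj₂ (v-free , ¬w∥v)
          rest-covered : ∀ {v} → Free D v × ¬ w ∥ v → Free (c ∷ D) v ⊎ Common c w v
          rest-covered {v} (v-free , ¬w∥v) with c ∥? v
          ... | yes c∥v = inj₁ (free-∷ c∥v v-free)
          ... | no ¬c∥v = inj₂ (proj₁ v-free , ∦⇒~ (λ { refl → ¬w∥v (∥-sym c∥w) }) ¬c∥v ,
                                               ∦⇒~ (λ { refl → ¬c∥v c∥w }) ¬w∥v)

        -- The two halves cover the clique and both contain Free {a, b, d, e}, so that set of at
        -- least 6 vertices is counted twice in 8 + 8.
        K-≤ : # K? + 6 ≤ 16
        K-≤ = begin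
          # K? + 6                        ≤⟨ +-monoʳ-≤ (# K?) (free₄-≥ I″) ⟩
          # K? + # (free? (a ∷ b ∷ D))    ≤⟨ #-exchange K? (free? (a ∷ b ∷ D)) Ka? Kb? K-covered
                                               (λ s-free → inj₁ (proj₁ (S⊆ s-free))) (λ _ s-free → S⊆ s-free) ⟩
          # Ka? + # Kb?                   ≤⟨ +-mono-≤ (half-bound I′ w-free stuck a~w c∥w) (half-bound I w-free stuck b~w c∥w) ⟩
          16                              ∎
          where
          S⊆ : ∀ {s} → Free (a ∷ b ∷ D) s → (Free (w ∷ D) s × a ∥ s) × (Free (w ∷ D) s × b ∥ s)
          S⊆ s-free@(x~s , a∥s ∷ b∥s ∷ D∥s) = ((x~s , w∥S s-free ∷ D∥s) , a∥s) , ((x~s , w∥S s-free ∷ D∥s) , b∥s)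

      stuck-impossible : ⊥
      stuck-impossible = <-irrefl refl (begin-strict
        -- `K-≥` serves as a strict inequality, since 33 ≤ m is 32 < m by definition; 22 is split as
        -- 6 + 16 to fit `K-≤`.
        32               <⟨ K-≥ ⟩
        # K? + 22        ≡⟨ +-assoc (# K?) 6 16 ⟨
        # K? + 6 + 16    ≤⟨ +-monoˡ-≤ 16 K-≤ ⟩
        32               ∎)

    -- Every free vertex extends, and the parity contradiction.

    extendable : ∀ {a b c d e w} → Independent (a ∷ b ∷ c ∷ d ∷ e ∷ []) →
                 Free (d ∷ e ∷ []) w → Extends (d ∷ e ∷ []) w
    extendable {a} {b} {c} {d} {e} {w} I w-free = decidable-stable (extends? (d ∷ e ∷ []) w) λ stuck →
      let I-acb = independent-resp-↭ (prep a (swap b c refl)) I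
          I-bca = independent-resp-↭ (trans (swap a b refl) (prep b (swap a c refl))) I
      -- A neighbour of `w` in each of the pairs {a, b}, {a, c}, {b, c} forces two neighbours among
      -- the three; the coclique is permuted to put those two first.
      in case adjacent-to-one I w-free stuck , adjacent-to-one I-acb w-free stuck , adjacent-to-one I-bca w-free stuck of λ where
        (inj₁ a~w , inj₂ c~w , _)        → stuck-impossible I-acb w-free stuck a~w c~w
        (inj₁ a~w , inj₁ _   , inj₁ b~w) → stuck-impossible I w-free stuck a~w b~w
        (inj₁ a~w , inj₁ _   , inj₂ c~w) → stuck-impossible I-acb w-free stuck a~w c~w
        (inj₂ b~w , inj₁ a~w , _)        → stuck-impossible I w-free stuck a~w b~w
        (inj₂ b~w , inj₂ c~w , _)        → stuck-impossible I-bca w-free stuck b~w c~w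

    -- By `extendable` each `p` in Free {d, e} lies in some 5-coclique with `d` and `e`, so
    -- `free₃-#` applies with `p` in the role of `c` and gives it 17 nonneighbours there. The degree
    -- sum 17 * 33 = 561 is odd.
    no-independent₅ : ∀ {a b c d e} → ¬ Independent (a ∷ b ∷ c ∷ d ∷ e ∷ [])
    no-independent₅ {d = d} {e} I = from-no (2 ∣? 561) (subst (2 ∣_) total
      (handshake nonadjacent?
        (λ { (p-free , x~q , p∥q ∷ D∥q) → (x~q , D∥q) , free-∷ (∥-sym p∥q) p-free })
        (λ { (_ , _ , p∥p ∷ _) → proj₁ p∥p refl })))
      where
      D : List (Fin n)
      D = d ∷ e ∷ []
      nonadjacent? : ∀ p → Decidable (λ q → Free D p × Free (p ∷ D) q)
      nonadjacent? p q = free? D p ×-dec free? (p ∷ D) q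
      degree : ∀ {p} → Free D p → # (nonadjacent? p) ≡ 17
      degree {p} p-free = case extendable I p-free of λ where
        (u , v , u-free , v-free) → ≡.trans
          (#-cong (nonadjacent? p) (free? (p ∷ D)) proj₂ (p-free ,_))
          (free₃-# (v-free ∷ u-free ∷ p-free ∷ independent-tail (independent-tail (independent-tail I))))
      total : ∑ (λ p → # (nonadjacent? p)) ≡ 561
      total = begin-equality
        ∑ (λ p → # (nonadjacent? p))   ≡⟨ ≤-antisym
                                            (∑≤*-# (free? D) nonadjacent? 17 (≤-reflexive ∘ degree) proj₁)
                                            (*-#≤∑ (free? D) nonadjacent? 17 (≤-reflexive ∘ sym ∘ degree)) ⟩
        17 * # (free? D)               ≡⟨ cong (17 *_) (free₂-# I) ⟩
        561                            ∎

-- Local parameters from the intersection array, and the passage from cocliques to independent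
-- lists.

module _ {n : ℕ} (Γ : Graph (Fin n)) where
  open Graph Γ

  distance₀ : ∀ {u} → Distance Γ 0 u u
  distance₀ = [] , λ ()

  distance₁ : ∀ {u v} → u ~ v → Distance Γ 1 u v
  distance₁ u~v = u~v ∷ [] , λ { (s≤s z≤n) [] → ~-irrefl refl u~v }

  distance₂ : ∀ {u v w} → u ≢ w → ¬ u ~ w → u ~ v → v ~ w → Distance Γ 2 u w
  distance₂ u≢w u≁w u~v v~w = u~v ∷ v~w ∷ [] , λ
    { (s≤s z≤n)       []         → u≢w refl
    ; (s≤s (s≤s z≤n)) (u~w ∷ []) → u≁w u~w
    }

  module _ (dr : DistanceRegular Γ (80 ∷ 54 ∷ 12 ∷ []) (1 ∷ 6 ∷ 60 ∷ [])) (x : Fin n) where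
    open DistanceRegular dr
    open LocalGraph Γ x

    degree : ∀ v → # (v ~?_) ≡ 80
    degree v = ≡.trans
      (#-cong (v ~?_) (λ z → (v ~? z) ×-dec distance? Γ 1 v z) (λ v~z → v~z , distance₁ v~z) proj₁)
      (b-count 0F distance₀)

    -- The neighbours of `s` lie at distance 0, 1 or 2 from `x`. Those at distance 0 or 2 number c₁
    -- + b₁ = 1 + 54 = 55 out of 80.
    local-valency : ∀ {s} → x ~ s → # (λ v → (x ~? v) ×-dec (s ~? v)) ≡ 25
    local-valency {s} x~s = +-cancelʳ-≡ 55 _ 25 (begin-equality
      # inside? + 55                  ≡⟨ cong (# inside? +_) outside-# ⟨
      # inside? + # outside?          ≡⟨ ≤-antisym
                                           (#-disjoint inside? outside? (s ~?_) proj₂ proj₁ (λ (x~v , _) (_ , x≁v) → x≁v x~v))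
                                           (#-∪ (s ~?_) inside? outside? inside-or-outside) ⟩
      # (s ~?_)                       ≡⟨ degree s ⟩
      80                              ∎)
      where
      inside? : Decidable (λ v → x ~ v × s ~ v)
      inside? v = (x ~? v) ×-dec (s ~? v)
      outside? : Decidable (λ v → s ~ v × ¬ x ~ v)
      outside? v = (s ~? v) ×-dec ¬? (x ~? v)
      at? : ∀ d → Decidable (λ v → s ~ v × Distance Γ d x v)
      at? d v = (s ~? v) ×-dec distance? Γ d x v
      inside-or-outside : ∀ {v} → s ~ v → (x ~ v × s ~ v) ⊎ (s ~ v × ¬ x ~ v)
      inside-or-outside {v} s~v with x ~? v
      ... | yes x~v = inj₁ (x~v , s~v)
      ... | no x≁v  = inj₂ (s~v , x≁v)
      at-0-or-2 : ∀ {v} → s ~ v × ¬ x ~ v → (s ~ v × Distance Γ 0 x v) ⊎ (s ~ v × Distance Γ 2 x v)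
      at-0-or-2 {v} (s~v , x≁v) with x ≟ᶠ v
      ... | yes refl = inj₁ (s~v , distance₀)
      ... | no x≢v   = inj₂ (s~v , distance₂ x≢v x≁v x~s s~v)
      outside-# : # outside? ≡ 55
      outside-# = begin-equality
        # outside?              ≡⟨ ≤-antisym
                                     (#-∪ outside? (at? 0) (at? 2) at-0-or-2)
                                     (#-disjoint (at? 0) (at? 2) outside?
                                       (λ { (s~v , [] , _) → s~v , ~-irrefl refl })
                                       (λ (s~v , _ , minimal) → s~v , λ x~v → minimal (s≤s (s≤s z≤n)) (x~v ∷ []))
                                       (λ (_ , walk₀ , _) (_ , _ , minimal) → minimal (s≤s z≤n) walk₀)) ⟩
        # (at? 0) + # (at? 2)   ≡⟨ cong₂ _+_ (c-count 0F (distance₁ x~s)) (b-count 1F (distance₁ x~s)) ⟩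
        55                      ∎

    -- In the whole graph `s` and `t` have c₂ = 6 common neighbours. One of them is `x`, which is
    -- not in its own local graph.
    local-common : ∀ {s t} → x ~ s → x ~ t → s ∥ t → # (common? s t) ≤ 5
    local-common {s} {t} x~s x~t (s≢t , s≁t) = +-cancelʳ-≤ 1 _ 5 (begin
      # (common? s t) + 1                              ≤⟨ #-remove (common? s t) (λ z → (t ~? z) ×-dec distance? Γ 1 s z)
                                                            (λ (_ , s~v , t~v) → t~v , distance₁ s~v)
                                                            (~-sym x~t , distance₁ (~-sym x~s))
                                                            (λ (x~x , _) → ~-irrefl refl x~x) ⟩
      # (λ z → (t ~? z) ×-dec distance? Γ 1 s z)       ≡⟨ c-count 1F (distance₂ s≢t s≁t (~-sym x~s) x~t) ⟩
      6                                                ∎)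

    local-parameters : Parameters
    local-parameters = record { order = degree x ; valency = local-valency ; common = local-common }

    coclique⇒independent : (C : Coclique (localGraph Γ x) 5) →
      let y = value ∘ Coclique.vertex C in Independent (y 0F ∷ y 1F ∷ y 2F ∷ y 3F ∷ y 4F ∷ [])
    coclique⇒independent C =
        (x~ 0F , ∥ 1F 0F (λ ()) ∷ ∥ 2F 0F (λ ()) ∷ ∥ 3F 0F (λ ()) ∷ ∥ 4F 0F (λ ()) ∷ [])
      ∷ (x~ 1F , ∥ 2F 1F (λ ()) ∷ ∥ 3F 1F (λ ()) ∷ ∥ 4F 1F (λ ()) ∷ [])
      ∷ (x~ 2F , ∥ 3F 2F (λ ()) ∷ ∥ 4F 2F (λ ()) ∷ [])
      ∷ (x~ 3F , ∥ 4F 3F (λ ()) ∷ [])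
      ∷ (x~ 4F , [])
      ∷ []
      where
      open Coclique C
      value-injective : ∀ {u v : [ y ∈ Fin n ∣ x ~ y ]} → value u ≡ value v → u ≡ v
      value-injective refl = refl
      adjacent : ∀ {v} → Irrelevant (x ~ v) → x ~ v
      -- The membership proof in the refinement type is irrelevant; decidability of adjacency
      -- recovers a usable one.
      adjacent {v} [ x~v ] = recompute (x ~? v) x~v
      x~ : ∀ i → x ~ value (vertex i)
      x~ i = adjacent (proof (vertex i))
      ∥ : ∀ i j → i ≢ j → value (vertex i) ∥ value (vertex j)
      ∥ i j i≢j = (λ eq → i≢j (Injection.injective vertices (value-injective eq))) , pairwise i≢j

proposition4p5 : ∀ {n : ℕ} (Γ : Graph (Fin n)) →
    DistanceRegular Γ (80 ∷ 54 ∷ 12 ∷ []) (1 ∷ 6 ∷ 60 ∷ []) →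
    (x : Fin n) → ¬ Coclique (localGraph Γ x) 5
proposition4p5 Γ dr x C =
  LocalGraph.no-independent₅ Γ x (local-parameters Γ dr x) (coclique⇒independent Γ dr x C)
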